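{- There exists a locally finite poset $P$ with a minimum element such that: (a) $P$ has the Möbius nonvanishing property: for every $x\in P$, the set $\{y\in P : \mu_P(x,y)\neq 0\}$ is infinite; and (b) $P$ does not have property $\mathcal{H}_2$: there is a two-element subset $S\subset P$ such that for each $z\in S$ there are only finitely many $x\in P$ with $x\geqslant z$ and $x\not\geqslant y$ for the other element $y\in S\setminus\{z\}$. In particular, $P$ has the Möbius nonvanishing property but does not have the Möbius uncertainty property, i.e. there exist functions $f,g:P\to\mathbb{C}$, neither identically zero, with $g(z)=\sum_{x\leqslant z}f(x)$ for all $z\in P$ and both $\{x: f(x)\neq 0\}$ and $\{x:g(x)\neq0\}$ finite.
   Context: A poset is locally finite if every interval $[x,y]=\{z: x\leqslant z\leqslant y\}$ is finite. The Möbius function $\mu_P$ of $P$ is defined on pairs $x,y\in P$ by $\mu_P(x,y)=1$ if $x=y$, $\mu_P(x,y)=-\sum_{x\leqslant z<y}\mu_P(x,z)$ if $x<y$, and $\mu_P(x,y)=0$ if $x\not\leqslant y$. -}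

module Defs where

open import Data.Integer.Base as ℤ using (ℤ; 0ℤ; 1ℤ)
open import Data.List.Base using (List; []; _∷_; _++_; map; foldr; filter; length)
open import Data.List.Membership.Propositional using (_∈_; mapWith∈)
open import Data.List.Membership.Propositional.Properties
  using (∈-∃++; ∈-++⁻; ∈-++⁺ˡ; ∈-++⁺ʳ; ∈-filter⁺; ∈-filter⁻; mapWith∈-cong; mapWith∈≗map)
open import Data.List.Properties using (length-++-sucʳ)
open import Data.List.Relation.Unary.All using (lookup; tabulate)
open import Data.List.Relation.Unary.Any using (here; there)
open import Data.List.Relation.Unary.AllPairs using ([]; _∷_)
open import Data.List.Relation.Unary.Unique.Propositional using (Unique)
open import Data.List.Relation.Unary.Unique.Propositional.Properties using (filter⁺)
open import Data.Nat.Base as ℕ using (ℕ; suc)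
import Data.Nat.Properties as ℕ
open import Data.Nat.Induction using (<-wellFounded)
open import Data.Product using (∃-syntax; _×_; _,_; proj₁; proj₂)
open import Data.Rational.Base as ℚ using (ℚ; 0ℚ; 1ℚ; ½)
import Data.Rational.Properties as ℚ
open import Data.Rational.Solver using (module +-*-Solver)
open import Data.Sum.Base using (inj₁; inj₂)
open import Function using (_⇔_; mk⇔; Equivalence)
open import Induction.WellFounded using (Acc; acc)
open import Level using (0ℓ)
open import Relation.Binary.Core using (Rel)
open import Relation.Binary.Definitions using (DecidableEquality; Decidable; Minimum)
open import Relation.Binary.Structures using (IsPartialOrder)
import Relation.Binary.Construct.NonStrictToStrict as NonStrictToStrict
open import Relation.Binary.PropositionalEquality
  using (_≡_; _≢_; refl; sym; trans; cong; subst)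
open import Relation.Nullary using (Dec; ¬_; yes; no; ¬?; contradiction)
open import Relation.Unary using (Pred)

-- A finite subset comes with a list of all its elements, without repetition.
Finite : {A : Set} → Pred A 0ℓ → Set
Finite Q = ∃[ xs ] Unique xs × (∀ x → x ∈ xs ⇔ Q x)

Infinite : {A : Set} → Pred A 0ℓ → Set
Infinite Q = ¬ Finite Q

module _ {A : Set} {Q : Pred A 0ℓ} (fin : Finite Q) where

  elements : List A
  elements = proj₁ fin

  elements-unique : Unique elements
  elements-unique = proj₁ (proj₂ fin)

  ∈-elements⁻ : ∀ {x} → x ∈ elements → Q x
  ∈-elements⁻ = Equivalence.to (proj₂ (proj₂ fin) _)

  ∈-elements⁺ : ∀ {x} → Q x → x ∈ elements
  ∈-elements⁺ = Equivalence.from (proj₂ (proj₂ fin) _)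

unique-⊆⇒length-≤ : {A : Set} {xs ys : List A} → Unique xs →
                    (∀ {z} → z ∈ xs → z ∈ ys) → length xs ℕ.≤ length ys
unique-⊆⇒length-≤ [] _ = ℕ.z≤n
unique-⊆⇒length-≤ {xs = x ∷ xs} (x≢xs ∷ u) sub with ∈-∃++ (sub (here refl))
... | as , bs , refl =
  subst (suc (length xs) ℕ.≤_) (sym (length-++-sucʳ as x bs))
    (ℕ.s≤s (unique-⊆⇒length-≤ u sub′))
  where
  sub′ : ∀ {z} → z ∈ xs → z ∈ as ++ bs
  sub′ z∈xs with ∈-++⁻ as (sub (there z∈xs))
  ... | inj₁ z∈as         = ∈-++⁺ˡ z∈as
  ... | inj₂ (here refl)  = contradiction refl (lookup x≢xs z∈xs)
  ... | inj₂ (there z∈bs) = ∈-++⁺ʳ as z∈bs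

sumℤ : List ℤ → ℤ
sumℤ = foldr ℤ._+_ 0ℤ

record LocallyFinitePoset : Set₁ where
  infix 4 _≤_
  field
    Carrier        : Set
    _≤_            : Rel Carrier 0ℓ
    isPartialOrder : IsPartialOrder _≡_ _≤_
    [_,_]-finite   : ∀ x y → Finite (λ z → x ≤ z × z ≤ y)

  open IsPartialOrder isPartialOrder public
    using (antisym) renaming (refl to ≤-refl; trans to ≤-trans; reflexive to ≤-reflexive)
  open NonStrictToStrict _≡_ _≤_ public using (_<_)

  [_,_] : Carrier → Carrier → List Carrier
  [ x , y ] = elements [ x , y ]-finite

  -- The order is decidable because x ≤ y exactly when [ x , y ] is nonempty.
  _≤?_ : Decidable _≤_
  x ≤? y with [ x , y ] | ∈-elements⁻ [ x , y ]-finite | ∈-elements⁺ [ x , y ]-finite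
  ... | []    | _  | from = no λ x≤y → contradiction (from (≤-refl , x≤y)) λ ()
  ... | _ ∷ _ | to | _    = yes (≤-trans (proj₁ (to (here refl))) (proj₂ (to (here refl))))

  _≟_ : DecidableEquality Carrier
  x ≟ y with x ≤? y | y ≤? x
  ... | yes x≤y | yes y≤x = yes (antisym x≤y y≤x)
  ... | no  x≰y | _       = no λ x≡y → x≰y (≤-reflexive x≡y)
  ... | yes _   | no y≰x  = no λ x≡y → y≰x (≤-reflexive (sym x≡y))

  [_,_⟩-finite : ∀ x y → Finite (λ z → x ≤ z × z < y)
  [ x , y ⟩-finite =
      filter ≢y? [ x , y ]
    , filter⁺ ≢y? (elements-unique [ x , y ]-finite)
    , λ z → mk⇔ to from
    where
    ≢y? = λ z → ¬? (z ≟ y)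
    to : ∀ {z} → z ∈ filter ≢y? [ x , y ] → x ≤ z × z < y
    to z∈ with ∈-filter⁻ ≢y? {xs = [ x , y ]} z∈
    ... | z∈[x,y] , z≢y with ∈-elements⁻ [ x , y ]-finite z∈[x,y]
    ...   | x≤z , z≤y = x≤z , z≤y , z≢y
    from : ∀ {z} → x ≤ z × z < y → z ∈ filter ≢y? [ x , y ]
    from (x≤z , z≤y , z≢y) = ∈-filter⁺ ≢y? (∈-elements⁺ [ x , y ]-finite (x≤z , z≤y)) z≢y

  [_,_⟩ : Carrier → Carrier → List Carrier
  [ x , y ⟩ = elements [ x , y ⟩-finite

  [,]-shrinks : ∀ {x y z} → x ≤ z → z < y → length [ x , z ] ℕ.< length [ x , y ]
  [,]-shrinks {x} {y} {z} x≤z (z≤y , z≢y) = unique-⊆⇒length-≤ u sub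
    where
    u : Unique (y ∷ [ x , z ])
    u = tabulate (λ { w∈ refl → z≢y (antisym z≤y (proj₂ (∈-elements⁻ [ x , z ]-finite w∈))) })
        ∷ elements-unique [ x , z ]-finite
    sub : ∀ {w} → w ∈ y ∷ [ x , z ] → w ∈ [ x , y ]
    sub (here refl) = ∈-elements⁺ [ x , y ]-finite (≤-trans x≤z z≤y , ≤-refl)
    sub (there w∈) with ∈-elements⁻ [ x , z ]-finite w∈
    ... | x≤w , w≤z = ∈-elements⁺ [ x , y ]-finite (x≤w , ≤-trans w≤z z≤y)

  [,⟩-shrinks : ∀ {x y z} → z ∈ [ x , y ⟩ → length [ x , z ] ℕ.< length [ x , y ]
  [,⟩-shrinks {x} {y} z∈ with ∈-elements⁻ [ x , y ⟩-finite z∈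
  ... | x≤z , z<y = [,]-shrinks x≤z z<y

  -- μ is defined by well-founded recursion on the length of [ x , y ]; its
  -- defining equations are μ-refl, μ-< and μ-≰ below.
  μ-cases : ∀ {x y} → Dec (x ≡ y) → Dec (x ≤ y) → (∑[x,y⟩ : ℤ) → ℤ
  μ-cases (yes _) _       _      = 1ℤ
  μ-cases (no _)  (yes _) ∑[x,y⟩ = ℤ.- ∑[x,y⟩
  μ-cases (no _)  (no _)  _      = 0ℤ

  μ-acc : ∀ x y → Acc ℕ._<_ (length [ x , y ]) → ℤ
  μ-acc x y (acc rs) = μ-cases (x ≟ y) (x ≤? y)
    (sumℤ (mapWith∈ [ x , y ⟩ λ {z} z∈ → μ-acc x z (rs ([,⟩-shrinks z∈))))

  μ : Carrier → Carrier → ℤ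
  μ x y = μ-acc x y (<-wellFounded _)

  μ-acc-irrelevant : ∀ x y (p q : Acc ℕ._<_ (length [ x , y ])) → μ-acc x y p ≡ μ-acc x y q
  μ-acc-irrelevant x y (acc p) (acc q) = cong (λ zs → μ-cases (x ≟ y) (x ≤? y) (sumℤ zs))
    (mapWith∈-cong [ x , y ⟩ _ _ λ {z} z∈ → μ-acc-irrelevant x z (p ([,⟩-shrinks z∈)) (q ([,⟩-shrinks z∈)))

  μ-unfold : ∀ x y → μ x y ≡ μ-cases (x ≟ y) (x ≤? y) (sumℤ (map (μ x) [ x , y ⟩))
  μ-unfold x y = go (<-wellFounded _)
    where
    go : ∀ p → μ-acc x y p ≡ μ-cases (x ≟ y) (x ≤? y) (sumℤ (map (μ x) [ x , y ⟩))
    go (acc rs) = cong (λ zs → μ-cases (x ≟ y) (x ≤? y) (sumℤ zs))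
      (trans (mapWith∈-cong [ x , y ⟩ _ _ λ {z} z∈ →
               μ-acc-irrelevant x z (rs ([,⟩-shrinks z∈)) (<-wellFounded _))
             (mapWith∈≗map (μ x) [ x , y ⟩))

  μ-refl : ∀ x → μ x x ≡ 1ℤ
  μ-refl x = trans (μ-unfold x x) (cases (x ≟ x) (x ≤? x))
    where
    cases : ∀ d e {s} → μ-cases {x} {x} d e s ≡ 1ℤ
    cases (yes _)  _ = refl
    cases (no x≢x) _ = contradiction refl x≢x

  μ-< : ∀ {x y} → x < y → μ x y ≡ ℤ.- sumℤ (map (μ x) [ x , y ⟩)
  μ-< {x} {y} (x≤y , x≢y) = trans (μ-unfold x y) (cases (x ≟ y) (x ≤? y))
    where
    cases : ∀ d e {s} → μ-cases {x} {y} d e s ≡ ℤ.- s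
    cases (yes x≡y) _        = contradiction x≡y x≢y
    cases (no _)    (yes _)  = refl
    cases (no _)    (no x≰y) = contradiction x≤y x≰y

  μ-≰ : ∀ {x y} → ¬ x ≤ y → μ x y ≡ 0ℤ
  μ-≰ {x} {y} x≰y = trans (μ-unfold x y) (cases (x ≟ y) (x ≤? y))
    where
    cases : ∀ d e {s} → μ-cases {x} {y} d e s ≡ 0ℤ
    cases (yes x≡y) _         = contradiction (≤-reflexive x≡y) x≰y
    cases (no _)    (yes x≤y) = contradiction x≤y x≰y
    cases (no _)    (no _)    = refl

  MöbiusNonvanishing : Set
  MöbiusNonvanishing = ∀ x → Infinite (λ y → μ x y ≢ 0ℤ)

  -- Since ⊥ is the minimum, {x : x ≤ z} is the interval [ ⊥ , z ].
  ↓-finite : ∀ {⊥} → Minimum _≤_ ⊥ → ∀ z → Finite (_≤ z)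
  ↓-finite {⊥} min z =
      [ ⊥ , z ]
    , elements-unique [ ⊥ , z ]-finite
    , λ x → mk⇔ (λ x∈ → proj₂ (∈-elements⁻ [ ⊥ , z ]-finite x∈))
                (λ x≤z → ∈-elements⁺ [ ⊥ , z ]-finite (min x , x≤z))

-- The Cauchy completion of ℚ, as a setoid under _≈ℝ_.
record ℝ : Set where
  field
    seq    : ℕ → ℚ
    cauchy : ∀ ε → 0ℚ ℚ.< ε →
             ∃[ N ] ∀ m n → N ℕ.≤ m → N ℕ.≤ n → ℚ.∣ seq m ℚ.- seq n ∣ ℚ.< ε

open ℝ public

infix 4 _≈ℝ_
_≈ℝ_ : Rel ℝ 0ℓ
x ≈ℝ y = ∀ ε → 0ℚ ℚ.< ε → ∃[ N ] ∀ n → N ℕ.≤ n → ℚ.∣ seq x n ℚ.- seq y n ∣ ℚ.< ε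

fromℚ : ℚ → ℝ
fromℚ q = record
  { seq    = λ _ → q
  ; cauchy = λ ε 0<ε → 0 , λ _ _ _ _ → subst (λ r → ℚ.∣ r ∣ ℚ.< ε) (sym (ℚ.+-inverseʳ q)) 0<ε
  }

infixl 6 _+ℝ_
_+ℝ_ : ℝ → ℝ → ℝ
seq    (x +ℝ y) n     = seq x n ℚ.+ seq y n
cauchy (x +ℝ y) ε 0<ε = N ℕ.⊔ M , λ m n N⊔M≤m N⊔M≤n → begin-strict
  ℚ.∣ (seq x m ℚ.+ seq y m) ℚ.- (seq x n ℚ.+ seq y n) ∣
    ≡⟨ cong ℚ.∣_∣ (rearrange (seq x m) (seq y m) (seq x n) (seq y n)) ⟩
  ℚ.∣ (seq x m ℚ.- seq x n) ℚ.+ (seq y m ℚ.- seq y n) ∣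
    ≤⟨ ℚ.∣p+q∣≤∣p∣+∣q∣ (seq x m ℚ.- seq x n) (seq y m ℚ.- seq y n) ⟩
  ℚ.∣ seq x m ℚ.- seq x n ∣ ℚ.+ ℚ.∣ seq y m ℚ.- seq y n ∣
    <⟨ ℚ.+-mono-< (x-close m n (ℕ.m⊔n≤o⇒m≤o N M N⊔M≤m) (ℕ.m⊔n≤o⇒m≤o N M N⊔M≤n))
                  (y-close m n (ℕ.m⊔n≤o⇒n≤o N M N⊔M≤m) (ℕ.m⊔n≤o⇒n≤o N M N⊔M≤n)) ⟩
  ½ ℚ.* ε ℚ.+ ½ ℚ.* ε
    ≡⟨ halves ε ⟩
  ε ∎
  where
  open ℚ.≤-Reasoning
  open +-*-Solver using (solve; con; _:+_; _:-_; _:*_; _:=_)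
  rearrange : ∀ a b c d → (a ℚ.+ b) ℚ.- (c ℚ.+ d) ≡ (a ℚ.- c) ℚ.+ (b ℚ.- d)
  rearrange = solve 4 (λ a b c d → (a :+ b) :- (c :+ d) := (a :- c) :+ (b :- d)) refl
  halves : ∀ e → ½ ℚ.* e ℚ.+ ½ ℚ.* e ≡ e
  halves = solve 1 (λ e → con ½ :* e :+ con ½ :* e := e) refl
  0<½ε : 0ℚ ℚ.< ½ ℚ.* ε
  0<½ε = subst (ℚ._< ½ ℚ.* ε) (ℚ.*-zeroʳ ½) (ℚ.*-monoʳ-<-pos ½ 0<ε)
  N = proj₁ (cauchy x (½ ℚ.* ε) 0<½ε)
  M = proj₁ (cauchy y (½ ℚ.* ε) 0<½ε)
  x-close = proj₂ (cauchy x (½ ℚ.* ε) 0<½ε)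
  y-close = proj₂ (cauchy y (½ ℚ.* ε) 0<½ε)

-- Only the additive structure of ℂ is needed to form g(z) = ∑_{x ≤ z} f(x).
record ℂ : Set where
  constructor _+i_
  field
    re im : ℝ

open ℂ public

infix 4 _≈ℂ_ _≉ℂ_
_≈ℂ_ _≉ℂ_ : Rel ℂ 0ℓ
w ≈ℂ z = re w ≈ℝ re z × im w ≈ℝ im z
w ≉ℂ z = ¬ (w ≈ℂ z)

0ℂ : ℂ
0ℂ = fromℚ 0ℚ +i fromℚ 0ℚ

infixl 6 _+ℂ_
_+ℂ_ : ℂ → ℂ → ℂ
w +ℂ z = (re w +ℝ re z) +i (im w +ℝ im z)

∑ : {A : Set} {Q : Pred A 0ℓ} → Finite Q → (A → ℂ) → ℂ
∑ fin f = foldr _+ℂ_ 0ℂ (map f (elements fin))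

{-# OPTIONS --safe #-}

-- Take the tree of finite sequences of naturals and let its nodes a = [0] and
-- b = [1] have the same children.  Every x still has infinitely many covers y,
-- each with μ(x,y) = −1, while a node other than a and b lies above a exactly
-- when it lies above b.  Hence f = δ_a − δ_b satisfies ∑_{x ≤ z} f(x) = f(z),
-- so g = f.
module Submission where

open import Defs
open import Data.Integer.Base using (1ℤ; -_)
open import Data.Integer.Properties using (+-identityʳ)
open import Data.List.Base using (List; []; _∷_; [_]; map; foldr; filter; deduplicate; concatMap; length; upTo)
open import Data.List.Membership.Propositional using (_∈_; _∉_; find; lose)
open import Data.List.Membership.Propositional.Properties
  using (∈-filter⁺; ∈-filter⁻; ∈-deduplicate⁺; ∈-deduplicate⁻; ∈-concatMap⁺; ∈-concatMap⁻; ∈-map⁻)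
open import Data.List.Properties using (≡-dec; length-map; length-upTo; ∷-injectiveˡ)
import Data.List.Membership.DecPropositional as DecMembership
open import Data.List.Relation.Unary.All using ([]; _∷_; lookup)
open import Data.List.Relation.Unary.AllPairs using ([]; _∷_)
open import Data.List.Relation.Unary.Any using (here; there)
open import Data.List.Relation.Unary.Unique.DecPropositional.Properties using (deduplicate-!)
open import Data.List.Relation.Unary.Unique.Propositional using (Unique)
open import Data.List.Relation.Unary.Unique.Propositional.Properties using (map⁺; upTo⁺)
open import Data.Nat.Base as ℕ using (ℕ; zero; suc; s≤s⁻¹)
import Data.Nat.Properties as ℕ
open import Data.Product using (Σ-syntax; ∃₂; _×_; _,_)
open import Data.Rational.Base as ℚ using (ℚ; 0ℚ; 1ℚ)
import Data.Rational.Properties as ℚ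
open import Data.Rational.Solver using (module +-*-Solver)
open import Data.Sum.Base using (_⊎_; inj₁; inj₂)
open import Function using (_∘_; mk⇔)
open import Level using (0ℓ)
open import Relation.Binary.Construct.Closure.ReflexiveTransitive using (Star; ε; _◅_; _◅◅_)
open import Relation.Binary.Core using (Rel)
open import Relation.Binary.Definitions using (Decidable; DecidableEquality; Minimum)
open import Relation.Binary.PropositionalEquality
  using (_≡_; _≢_; refl; sym; trans; cong; cong₂; subst; isEquivalence; module ≡-Reasoning)
open import Relation.Nullary using (¬_; yes; no; contradiction)
open import Relation.Nullary.Decidable using (map′)
open import Relation.Unary using (Pred)

-- Infinite subsets and one-element lists.

infinite : {A : Set} {Q : Pred A 0ℓ} (h : ℕ → A) → (∀ {m n} → h m ≡ h n → m ≡ n) →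
           (∀ n → Q (h n)) → Infinite Q
infinite h h-injective Qh fin =
  -- Pigeonhole: `h` takes `suc N` distinct values on `upTo (suc N)`, too many for a list of length
  -- `N`.
  ℕ.1+n≰n (subst (ℕ._≤ N) #hs (unique-⊆⇒length-≤ {xs = hs} hs! ⊆elements))
  where
  N   = length (elements fin)
  hs  = map h (upTo (suc N))
  #hs : length hs ≡ suc N
  #hs = trans (length-map h (upTo (suc N))) (length-upTo (suc N))
  hs! : Unique hs
  hs! = map⁺ h-injective (upTo⁺ (suc N))
  ⊆elements : ∀ {z} → z ∈ hs → z ∈ elements fin
  ⊆elements z∈ with ∈-map⁻ h z∈
  ... | n , _ , refl = ∈-elements⁺ fin (Qh n)

unique-constant : {A : Set} {x : A} {xs : List A} → Unique xs → x ∈ xs →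
                  (∀ {z} → z ∈ xs → z ≡ x) → xs ≡ [ x ]
unique-constant {xs = y ∷ []}    _               _ ≡x = cong [_] (≡x (here refl))
unique-constant {xs = y ∷ z ∷ _} ((y≢z ∷ _) ∷ _) _ ≡x =
  contradiction (trans (≡x (here refl)) (sym (≡x (there (here refl))))) y≢z

-- The Möbius function on covering pairs.

module _ (P : LocallyFinitePoset) where
  open LocallyFinitePoset P

  -- The half-open interval from `x` to `y` contains only `x`, so the defining sum has the single
  -- term `μ x x`.
  μ-cover : ∀ {x y} → x < y → (∀ {z} → x ≤ z → z < y → z ≡ x) → μ x y ≡ - 1ℤ
  μ-cover {x} {y} x<y between = begin
    μ x y                            ≡⟨ μ-< x<y ⟩
    - sumℤ (map (μ x) [ x , y ⟩)     ≡⟨ cong (λ zs → - sumℤ (map (μ x) zs)) [x,y⟩≡[x] ⟩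
    - sumℤ (μ x x ∷ [])              ≡⟨ cong -_ (+-identityʳ (μ x x)) ⟩
    - μ x x                          ≡⟨ cong -_ (μ-refl x) ⟩
    - 1ℤ                             ∎
    where
    open ≡-Reasoning
    [x,y⟩≡[x] : [ x , y ⟩ ≡ x ∷ []
    [x,y⟩≡[x] = unique-constant (elements-unique [ x , y ⟩-finite)
      (∈-elements⁺ [ x , y ⟩-finite (≤-refl , x<y))
      λ z∈ → let x≤z , z<y = ∈-elements⁻ [ x , y ⟩-finite z∈ in between x≤z z<y

-- Locally finite posets generated by a graded parent relation.

module Graded {A : Set} (_≟_ : DecidableEquality A) (rank : A → ℕ) (parents : A → List A)
              (rank-parent : ∀ {x y} → x ∈ parents y → rank y ≡ suc (rank x)) where

  infix 4 _⋖_ _≤_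
  _⋖_ _≤_ : Rel A 0ℓ
  x ⋖ y = x ∈ parents y
  _≤_   = Star _⋖_

  rank-mono : ∀ {x y} → x ≤ y → x ≡ y ⊎ rank x ℕ.< rank y
  rank-mono ε             = inj₁ refl
  rank-mono (x⋖y ◅ y≤z) with rank-mono y≤z
  ... | inj₁ refl = inj₂ (ℕ.≤-reflexive (sym (rank-parent x⋖y)))
  ... | inj₂ y<z  = inj₂ (ℕ.<-trans (ℕ.≤-reflexive (sym (rank-parent x⋖y))) y<z)

  -- A chain with at least one step raises the rank strictly, so without such a rise the chain is
  -- empty.
  rank-≤⇒≡ : ∀ {x y} → x ≤ y → rank y ℕ.≤ rank x → x ≡ y
  rank-≤⇒≡ x≤y ry≤rx with rank-mono x≤y
  ... | inj₁ x≡y   = x≡y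
  ... | inj₂ rx<ry = contradiction rx<ry (ℕ.≤⇒≯ ry≤rx)

  antisym : ∀ {x y} → x ≤ y → y ≤ x → x ≡ y
  antisym x≤y y≤x with rank-mono y≤x
  ... | inj₁ y≡x   = sym y≡x
  ... | inj₂ ry<rx = rank-≤⇒≡ x≤y (ℕ.<⇒≤ ry<rx)

  -- The number bounds the length of the descending chains followed and makes the recursion
  -- structural. The bound `rank y` suffices, since each step to a parent lowers the rank by one.
  below : ℕ → A → List A
  below zero    y = [ y ]
  below (suc k) y = y ∷ concatMap (below k) (parents y)

  below-self : ∀ k {y} → y ∈ below k y
  below-self zero    = here refl
  below-self (suc k) = here refl

  below-sound : ∀ k {x y} → x ∈ below k y → x ≤ y
  below-sound zero    (here refl) = ε
  below-sound (suc k) (here refl) = ε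
  below-sound (suc k) {y = y} (there x∈)
    with find (∈-concatMap⁻ (below k) {xs = parents y} x∈)
  ... | p , p⋖y , x∈p = below-sound k x∈p ◅◅ p⋖y ◅ ε

  -- The bound is never exhausted too early: passing from `z` to a parent lowers `rank z` and `k`
  -- together, and at rank `0` there are no parents left.
  below-⋖ : ∀ k {x y z} → rank z ℕ.≤ k → x ⋖ y → y ∈ below k z → x ∈ below k z
  below-⋖ zero    rz≤k x⋖y (here refl) =
    contradiction (subst (ℕ._≤ 0) (rank-parent x⋖y) rz≤k) λ ()
  below-⋖ (suc k) rz≤k x⋖y (here refl) =
    there (∈-concatMap⁺ (below k) (lose x⋖y (below-self k)))
  below-⋖ (suc k) {z = z} rz≤k x⋖y (there y∈)
    with find (∈-concatMap⁻ (below k) {xs = parents z} y∈)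
  ... | p , p⋖z , y∈p = there (∈-concatMap⁺ (below k) (lose p⋖z
    (below-⋖ k (s≤s⁻¹ (subst (ℕ._≤ suc k) (rank-parent p⋖z) rz≤k)) x⋖y y∈p)))

  below-complete : ∀ {x z} → x ≤ z → x ∈ below (rank z) z
  below-complete {z = z} ε           = below-self (rank z)
  below-complete {z = z} (x⋖y ◅ y≤z) = below-⋖ (rank z) ℕ.≤-refl x⋖y (below-complete y≤z)

  infix 4 _≤?_
  _≤?_ : Decidable _≤_
  x ≤? y = map′ (below-sound (rank y)) below-complete (x ∈? below (rank y) y)
    where open DecMembership _≟_ using (_∈?_)

  interval-finite : ∀ x y → Finite (λ z → x ≤ z × z ≤ y)
  interval-finite x y =
      -- An element reached along several descending chains occurs several times in `below`.
      deduplicate _≟_ zs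
    , deduplicate-! _≟_ zs
    , λ z → mk⇔
        (λ z∈ → let z∈below , x≤z = ∈-filter⁻ (x ≤?_) {xs = below (rank y) y} (∈-deduplicate⁻ _≟_ zs z∈)
                in x≤z , below-sound (rank y) z∈below)
        (λ (x≤z , z≤y) → ∈-deduplicate⁺ _≟_ (∈-filter⁺ (x ≤?_) (below-complete z≤y) x≤z))
    where
    zs : List A
    zs = filter (x ≤?_) (below (rank y) y)

  poset : LocallyFinitePoset
  poset = record
    { Carrier        = A
    ; _≤_            = _≤_
    ; isPartialOrder = record
      { isPreorder = record
        { isEquivalence = isEquivalence
        ; reflexive     = λ { refl → ε }
        ; trans         = _◅◅_
        }
      ; antisym = antisym
      }
    ; [_,_]-finite   = interval-finite
    }

  open LocallyFinitePoset poset using (μ)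

  -- If `x ≤ z < y`, then `rank z < rank y = suc (rank x)`, so `z` has rank at most that of `x` and
  -- equals `x`. Hence `y` covers `x`.
  μ-⋖ : ∀ {x y} → x ⋖ y → μ x y ≡ - 1ℤ
  μ-⋖ {x} {y} x⋖y = μ-cover poset (x⋖y ◅ ε , x≢y) λ {z} x≤z (z≤y , z≢y) →
    sym (rank-≤⇒≡ x≤z (s≤s⁻¹ (subst (suc (rank z) ℕ.≤_) (rank-parent x⋖y) (strict z≤y z≢y))))
    where
    x≢y : x ≢ y
    x≢y refl = ℕ.1+n≢n (sym (rank-parent x⋖y))
    strict : ∀ {z} → z ≤ y → z ≢ y → rank z ℕ.< rank y
    strict z≤y z≢y with rank-mono z≤y
    ... | inj₁ z≡y   = contradiction z≡y z≢y
    ... | inj₂ rz<ry = rz<ry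

  module Siblings {a b : A} (a≢b : a ≢ b) (same-rank : rank a ≡ rank b)
                  (a⋖⇒b⋖ : ∀ {y} → a ⋖ y → b ⋖ y) where

    b≰a : ¬ b ≤ a
    b≰a b≤a = a≢b (sym (rank-≤⇒≡ b≤a (ℕ.≤-reflexive same-rank)))

    -- A chain from `a` to another element starts with some `a ⋖ y`; replacing this step by `b ⋖ y`
    -- gives a chain from `b`.
    above : ∀ {z} → a ≤ z → z ≢ a → b ≤ z
    above ε           z≢a = contradiction refl z≢a
    above (a⋖y ◅ y≤z) _   = a⋖⇒b⋖ a⋖y ◅ y≤z

    -- By `above`, only `a` itself can lie over `a` but not over `b`.
    difference-finite : Finite (λ z → a ≤ z × ¬ (b ≤ z))
    difference-finite = [ a ] , [] ∷ [] , λ z → mk⇔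
      (λ { (here refl) → ε , b≰a })
      (λ (a≤z , b≰z) → only a≤z b≰z)
      where
      only : ∀ {z} → a ≤ z → ¬ (b ≤ z) → z ∈ [ a ]
      only {z} a≤z b≰z with z ≟ a
      ... | yes refl = here refl
      ... | no  z≢a  = contradiction (above a≤z z≢a) b≰z

-- Rational sums of point masses.

sumℚ : List ℚ → ℚ
sumℚ = foldr ℚ._+_ 0ℚ

sumℚ-map-− : {A : Set} (φ ψ : A → ℚ) (xs : List A) →
             sumℚ (map (λ x → φ x ℚ.- ψ x) xs) ≡ sumℚ (map φ xs) ℚ.- sumℚ (map ψ xs)
sumℚ-map-− φ ψ []       = refl
sumℚ-map-− φ ψ (x ∷ xs) = trans (cong (φ x ℚ.- ψ x ℚ.+_) (sumℚ-map-− φ ψ xs))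
  (rearrange (φ x) (ψ x) (sumℚ (map φ xs)) (sumℚ (map ψ xs)))
  where
  open +-*-Solver using (solve; _:+_; _:-_; _:=_)
  rearrange : ∀ p q r s → (p ℚ.- q) ℚ.+ (r ℚ.- s) ≡ (p ℚ.+ r) ℚ.- (q ℚ.+ s)
  rearrange = solve 4 (λ p q r s → (p :- q) :+ (r :- s) := (p :+ r) :- (q :+ s)) refl

module _ {A : Set} (_≟_ : DecidableEquality A) where

  δ : A → A → ℚ
  δ a x with a ≟ x
  ... | yes _ = 1ℚ
  ... | no  _ = 0ℚ

  δ-≡ : ∀ {a x} → a ≡ x → δ a x ≡ 1ℚ
  δ-≡ {a} {x} a≡x with a ≟ x
  ... | yes _   = refl
  ... | no  a≢x = contradiction a≡x a≢x

  δ-≢ : ∀ {a x} → a ≢ x → δ a x ≡ 0ℚ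
  δ-≢ {a} {x} a≢x with a ≟ x
  ... | yes a≡x = contradiction a≡x a≢x
  ... | no  _   = refl

  sumℚ-δ-∉ : ∀ {a} xs → a ∉ xs → sumℚ (map (δ a) xs) ≡ 0ℚ
  sumℚ-δ-∉ []       _  = refl
  sumℚ-δ-∉ (x ∷ xs) a∉ = cong₂ ℚ._+_ (δ-≢ (a∉ ∘ here)) (sumℚ-δ-∉ xs (a∉ ∘ there))

  sumℚ-δ-∈ : ∀ {a xs} → Unique xs → a ∈ xs → sumℚ (map (δ a) xs) ≡ 1ℚ
  sumℚ-δ-∈ {xs = _ ∷ xs} (a≢xs ∷ _) (here refl) =
    cong₂ ℚ._+_ (δ-≡ refl) (sumℚ-δ-∉ xs λ a∈ → lookup a≢xs a∈ refl)
  sumℚ-δ-∈ (x≢xs ∷ u) (there a∈) =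
    cong₂ ℚ._+_ (δ-≢ λ a≡x → lookup x≢xs a∈ (sym a≡x)) (sumℚ-δ-∈ u a∈)

-- Rational numbers inside the complex numbers.

≈ℝ-pointwise : ∀ x y → (∀ n → seq x n ≡ seq y n) → x ≈ℝ y
≈ℝ-pointwise x y x≡y r 0<r = 0 , λ n _ → subst (ℚ._< r) (sym (∣x-y∣≡0 n)) 0<r
  where
  ∣x-y∣≡0 : ∀ n → ℚ.∣ seq x n ℚ.- seq y n ∣ ≡ 0ℚ
  ∣x-y∣≡0 n = cong ℚ.∣_∣ (trans (cong (ℚ._- seq y n) (x≡y n)) (ℚ.+-inverseʳ (seq y n)))

ι : ℚ → ℂ
ι q = fromℚ q +i fromℚ 0ℚ

-- Addition in `ℂ` is termwise on the Cauchy sequences and every summand is constant, so at each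
-- index the claim is an identity of rational sums.
ι-∑ : {A : Set} {Q : Pred A 0ℓ} (fin : Finite Q) (φ : A → ℚ) {q : ℚ} →
      q ≡ sumℚ (map φ (elements fin)) → ι q ≈ℂ ∑ fin (ι ∘ φ)
ι-∑ {A} fin φ {q} q≡ =
    ≈ℝ-pointwise (re (ι q)) (re ∑f) (λ n → trans q≡ (re-∑ n (elements fin)))
  , ≈ℝ-pointwise (im (ι q)) (im ∑f) (λ n → im-∑ n (elements fin))
  where
  ∑f = ∑ fin (ι ∘ φ)
  re-∑ : ∀ n (xs : List A) → sumℚ (map φ xs) ≡ seq (re (foldr _+ℂ_ 0ℂ (map (ι ∘ φ) xs))) n
  re-∑ n []       = refl
  re-∑ n (x ∷ xs) = cong (φ x ℚ.+_) (re-∑ n xs)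
  im-∑ : ∀ n (xs : List A) → 0ℚ ≡ seq (im (foldr _+ℂ_ 0ℂ (map (ι ∘ φ) xs))) n
  im-∑ n []       = refl
  im-∑ n (x ∷ xs) = cong (0ℚ ℚ.+_) (im-∑ n xs)

ι-0 : ∀ {q} → q ≡ 0ℚ → ι q ≈ℂ 0ℂ
ι-0 refl = ≈ℝ-pointwise (re 0ℂ) (re 0ℂ) (λ _ → refl) , ≈ℝ-pointwise (im 0ℂ) (im 0ℂ) (λ _ → refl)

-- Closeness to zero within tolerance `1` would give `∣q∣ < 1`. The absolute value lets one lemma
-- serve both values `1` and `-1` of `φ`.
∣q∣≡1⇒ι-≉0 : ∀ {q} → ℚ.∣ q ∣ ≡ 1ℚ → ι q ≉ℂ 0ℂ
∣q∣≡1⇒ι-≉0 {q} ∣q∣≡1 (re≈0 , _) =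
  let N , close = re≈0 1ℚ (ℚ.positive⁻¹ 1ℚ)
  in ℚ.<-irrefl ∣q∣≡1 (subst (λ r → ℚ.∣ r ∣ ℚ.< 1ℚ) (ℚ.+-identityʳ q) (close N ℕ.≤-refl))

-- The tree of finite sequences with two nodes sharing their children.

_≟ˡ_ : DecidableEquality (List ℕ)
_≟ˡ_ = ≡-dec ℕ._≟_

twins : List ℕ → List (List ℕ)
twins (0 ∷ []) = [ 1 ∷ [] ]
twins (1 ∷ []) = [ 0 ∷ [] ]
twins _        = []

-- Sequences grow at the head: the tail is the parent in the tree, and a twin of the tail becomes a
-- second parent.
parents : List ℕ → List (List ℕ)
parents []       = []
parents (_ ∷ xs) = xs ∷ twins xs

length-twin : ∀ {xs} ys → xs ∈ twins ys → length ys ≡ length xs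
length-twin (0 ∷ []) (here refl) = refl
length-twin (1 ∷ []) (here refl) = refl

length-parent : ∀ {xs ys} → xs ∈ parents ys → length ys ≡ suc (length xs)
length-parent {ys = _ ∷ ys} (here refl) = refl
length-parent {ys = _ ∷ ys} (there xs∈) = cong suc (length-twin ys xs∈)

open Graded _≟ˡ_ length parents length-parent renaming (_≤_ to _⊑_; _≤?_ to _⊑?_)

a b : List ℕ
a = 0 ∷ []
b = 1 ∷ []

a≢b : a ≢ b
a≢b ()

twin-sym : ∀ {xs} ys → xs ∈ twins ys → ys ∈ twins xs
twin-sym (0 ∷ []) (here refl) = here refl
twin-sym (1 ∷ []) (here refl) = here refl

-- Either the tail of `ys` is `a`, which has `b` as its twin, or the tail is a twin of `a`, hence
-- `b` itself.
a⋖⇒b⋖ : ∀ {ys} → a ⋖ ys → b ⋖ ys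
a⋖⇒b⋖ {_ ∷ _}  (here refl) = there (here refl)
a⋖⇒b⋖ {_ ∷ ys} (there a∈) with twin-sym ys a∈
... | here refl = here refl

b⋖⇒a⋖ : ∀ {ys} → b ⋖ ys → a ⋖ ys
b⋖⇒a⋖ {_ ∷ _}  (here refl) = there (here refl)
b⋖⇒a⋖ {_ ∷ ys} (there b∈) with twin-sym ys b∈
... | here refl = here refl

-- In `BA` the two roles are exchanged: `BA.b≰a` refutes `a ⊑ b`, and `BA.above` passes from `b` to
-- `a`.
module AB = Siblings a≢b refl a⋖⇒b⋖
module BA = Siblings (a≢b ∘ sym) refl b⋖⇒a⋖

[]-minimum : Minimum _⊑_ []
[]-minimum []       = ε
[]-minimum (x ∷ xs) = []-minimum xs ◅◅ here refl ◅ ε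

module P = LocallyFinitePoset poset

nonvanishing : P.MöbiusNonvanishing
-- The children `n ∷ x` are pairwise distinct covers of `x`, so `μ` is `-1` at each of them.
nonvanishing x = infinite (_∷ x) ∷-injectiveˡ λ n μ≡0 →
  contradiction (trans (sym (μ-⋖ {x} (here refl))) μ≡0) λ ()

-- The finitely supported function equal to its own sum.

φ : List ℕ → ℚ
φ x = δ _≟ˡ_ a x ℚ.- δ _≟ˡ_ b x

φ-off-ab : ∀ {x} → x ≢ a → x ≢ b → φ x ≡ 0ℚ
φ-off-ab x≢a x≢b = cong₂ ℚ._-_ (δ-≢ _≟ˡ_ (x≢a ∘ sym)) (δ-≢ _≟ˡ_ (x≢b ∘ sym))

-- The sum is the indicator of `a ⊑ z` minus that of `b ⊑ z`. It is `1` at `a` and `-1` at `b`;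
-- elsewhere the two conditions hold or fail together and it vanishes.
φ-eigenfunction : ∀ z → φ z ≡ sumℚ (map φ (elements (P.↓-finite []-minimum z)))
φ-eigenfunction z = sym (trans (sumℚ-map-− (δ _≟ˡ_ a) (δ _≟ˡ_ b) (elements ↓z)) sums)
  where
  ↓z = P.↓-finite []-minimum z
  ∑δ : List ℕ → ℚ
  ∑δ c = sumℚ (map (δ _≟ˡ_ c) (elements ↓z))
  ∑δ-⊑ : ∀ {c} → c ⊑ z → ∑δ c ≡ 1ℚ
  ∑δ-⊑ c⊑z = sumℚ-δ-∈ _≟ˡ_ (elements-unique ↓z) (∈-elements⁺ ↓z c⊑z)
  ∑δ-⋢ : ∀ {c} → ¬ c ⊑ z → ∑δ c ≡ 0ℚ
  ∑δ-⋢ c⋢z = sumℚ-δ-∉ _≟ˡ_ (elements ↓z) (c⋢z ∘ ∈-elements⁻ ↓z)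
  sums : ∑δ a ℚ.- ∑δ b ≡ φ z
  sums with z ≟ˡ a | z ≟ˡ b
  ... | yes refl | _        = cong₂ ℚ._-_ (∑δ-⊑ ε) (∑δ-⋢ AB.b≰a)
  ... | no _     | yes refl = cong₂ ℚ._-_ (∑δ-⋢ BA.b≰a) (∑δ-⊑ ε)
  ... | no z≢a   | no z≢b with a ⊑? z
  ...   | yes a⊑z = trans (cong₂ ℚ._-_ (∑δ-⊑ a⊑z) (∑δ-⊑ (AB.above a⊑z z≢a))) (sym (φ-off-ab z≢a z≢b))
  ...   | no  a⋢z = trans (cong₂ ℚ._-_ (∑δ-⋢ a⋢z) (∑δ-⋢ λ b⊑z → a⋢z (BA.above b⊑z z≢b)))
                          (sym (φ-off-ab z≢a z≢b))

f : List ℕ → ℂ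
f = ι ∘ φ

f-a≉0 : f a ≉ℂ 0ℂ
f-a≉0 = ∣q∣≡1⇒ι-≉0 {φ a} refl

f-b≉0 : f b ≉ℂ 0ℂ
f-b≉0 = ∣q∣≡1⇒ι-≉0 {φ b} refl

f-support-finite : Finite (λ x → f x ≉ℂ 0ℂ)
f-support-finite = a ∷ b ∷ [] , (a≢b ∷ []) ∷ [] ∷ [] , λ x → mk⇔
  (λ { (here refl) → f-a≉0 ; (there (here refl)) → f-b≉0 })
  (support x)
  where
  support : ∀ x → f x ≉ℂ 0ℂ → x ∈ a ∷ b ∷ []
  support x fx≉0 with x ≟ˡ a | x ≟ˡ b
  ... | yes x≡a | _       = here x≡a
  ... | no _    | yes x≡b = there (here x≡b)
  ... | no x≢a  | no x≢b  = contradiction (ι-0 (φ-off-ab x≢a x≢b)) fx≉0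

theorem1p6 : Σ[ P ∈ LocallyFinitePoset ]
    let open LocallyFinitePoset P in
    Σ[ ⊥ ∈ Carrier ] Σ[ min ∈ Minimum _≤_ ⊥ ]
    MöbiusNonvanishing
    × (∃₂ λ (a b : Carrier) →
    a ≢ b
    × Finite (λ x → a ≤ x × ¬ (b ≤ x))
    × Finite (λ x → b ≤ x × ¬ (a ≤ x)))
    × (∃₂ λ (f g : Carrier → ℂ) →
    ¬ (∀ x → f x ≈ℂ 0ℂ)
    × ¬ (∀ x → g x ≈ℂ 0ℂ)
    × (∀ z → g z ≈ℂ ∑ (↓-finite min z) f)
    × Finite (λ x → f x ≉ℂ 0ℂ)
    × Finite (λ x → g x ≉ℂ 0ℂ))
theorem1p6 =
    poset , [] , []-minimum
  , nonvanishing
  , (a , b , a≢b , AB.difference-finite , BA.difference-finite)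
  , f , f , (λ f≈0 → f-a≉0 (f≈0 a)) , (λ f≈0 → f-a≉0 (f≈0 a))
  , (λ z → ι-∑ (P.↓-finite []-minimum z) φ (φ-eigenfunction z))
  , f-support-finite , f-support-finite
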